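{- Let $k\in\mathbb{Z}_{\ge1}$, let $H$ be a $(k+1)$-uniform hypergraph, let $q,w\in\mathbb{C}$ with $w^k\neq1$, and let $(w^k-1)^{1/k}$ denote a fixed choice of $k$-th root of $w^k-1$ (with $(w^k-1)^{n/k}$ meaning its $n$-th power for integers $n$). Then $$Z_{\mathrm{P}}(H;q,w)=q^{\kappa(H)}\,(w^k-1)^{\frac{v(H)-\kappa(H)}{k}}\;T_{\mathrm{HG}}\!\left(H;\frac{q}{(w^k-1)^{1/k}}+1,\;(w^k-1)^{1/k}+1\right).$$
   Context: A hypergraph is a pair $H=(V,E)$ where $V$ is a finite set and $E$ is a finite multiset (parallel hyperedges are allowed and treated as distinct elements of $E$) of multisets of elements of $V$, called hyperedges. For $e\in E$, $d(e)$ is the size of $e$ counted with multiplicity; it is always assumed that $d(e)>1$. $H$ is $(k+1)$-uniform if $d(e)=k+1$ for all $e\in E$. Write $v(H)=|V|$. $\kappa(H)$ is the number of connected components of the bipartite incidence graph with vertex classes $V$ and $E$, in which $u\in V$ and $e\in E$ are joined by as many edges as the multiplicity of $u$ in $e$. For $A\subseteq E$ let $\kappa(A)=\kappa((V,A))$, $d(A)=\sum_{e\in A}d(e)$, and $|A|$ is the number of hyperedges in $A$. Hypergraph Tutte polynomial: $T_{\mathrm{HG}}(H;x,y)=\sum_{A\subseteq E}(x-1)^{\kappa(A)-\kappa(H)}(y-1)^{d(A)-|A|-v(H)+\kappa(A)}$. Degree-dependent hypergraph Potts partition function: $Z_{\mathrm{P}}(H;q,w)=\sum_{A\subseteq E}q^{\kappa(A)}\prod_{e\in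 A}(w^{d(e)-1}-1)$. -}

module Defs where

open import Algebra.Apartness.Bundles using (HeytingCommutativeRing; HeytingField)
open import Algebra.Bundles using (CommutativeRing)
import Algebra.Apartness.Properties.HeytingCommutativeRing as HeytingProperties
import Algebra.Properties.Semiring.Exp as Exp
open import Data.Fin.Base using (Fin; zero; suc; _↑ˡ_; _↑ʳ_; punchIn; punchOut)
open import Data.Fin.Properties using (_≟_; punchOut-cong; punchOut-injective; punchOut-punchIn; punchInᵢ≢i)
open import Data.List.Base using (List; []; _∷_; _++_; map; foldr; length; concat; tabulate; lookup)
open import Data.List.Membership.Propositional using (_∈_)
open import Data.List.Relation.Unary.All using (All)
open import Data.List.Relation.Unary.Any using (here; there)
open import Data.Nat.Base as ℕ using (ℕ; zero; suc; _<_; _∸_)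
open import Data.Nat.ListAction using (sum)
open import Data.Product.Base using (∃; _×_; _,_; proj₁)
open import Data.Sum.Base using (inj₁; inj₂)
open import Function.Base using (_∘_; id)
open import Function.Bundles using (_⇔_; mk⇔; Equivalence)
open import Relation.Binary.Construct.Closure.Equivalence as EqClosure using (EqClosure)
open import Relation.Binary.Construct.Closure.ReflexiveTransitive using (ε; _◅_; _◅◅_)
open import Relation.Binary.Construct.Closure.Symmetric using (fwd; bwd)
open import Relation.Binary.PropositionalEquality using (_≡_; _≢_; refl; sym; trans; cong; isEquivalence)
import Relation.Binary.Construct.On as On
open import Relation.Nullary using (Dec; yes; no; contradiction)

-- A multigraph on the vertex set Fin n, given by its list of edges; the
-- orientation recorded in a pair is irrelevant, see Connected.
Multigraph : ℕ → Set
Multigraph n = List (Fin n × Fin n)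

Adjacent : ∀ {n} → Multigraph n → Fin n → Fin n → Set
Adjacent G x y = (x , y) ∈ G

Connected : ∀ {n} → Multigraph n → Fin n → Fin n → Set
Connected G = EqClosure (Adjacent G)

-- The fibres of label are exactly the connected components of G, and each of
-- the count labels is used, so count is the number of components.
record Components {n} (G : Multigraph n) : Set where
  field
    count   : ℕ
    label   : Fin n → Fin count
    onto    : ∀ i → ∃ λ x → label x ≡ i
    correct : ∀ x y → label x ≡ label y ⇔ Connected G x y

-- redirect i j sends j to i and fixes everything else; contract i j then
-- closes the gap left at j.
redirect : ∀ {n} (i j x : Fin n) → Dec (j ≡ x) → Fin n
redirect i j x (yes _) = i
redirect i j x (no _)  = x

redirect-≢ : ∀ {n} {i j : Fin n} → j ≢ i → ∀ x d → j ≢ redirect i j x d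
redirect-≢ j≢i x (yes _)  = j≢i
redirect-≢ j≢i x (no j≢x) = j≢x

contract : ∀ {n} (i j : Fin (suc n)) → j ≢ i → Fin (suc n) → Fin n
contract i j j≢i x = punchOut (redirect-≢ j≢i x (j ≟ x))

contract-onto : ∀ {n} (i j : Fin (suc n)) (j≢i : j ≢ i) z →
                contract i j j≢i (punchIn j z) ≡ z
contract-onto i j j≢i z with j ≟ punchIn j z
... | yes j≡  = contradiction (sym j≡) (punchInᵢ≢i j z)
... | no  _   = trans (punchOut-cong j refl) (punchOut-punchIn j)

contract-merges : ∀ {n} (i j : Fin (suc n)) (j≢i : j ≢ i) →
                  contract i j j≢i i ≡ contract i j j≢i j
contract-merges i j j≢i with j ≟ i | j ≟ j
... | yes j≡i | _       = contradiction j≡i j≢i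
... | no _    | yes _   = punchOut-cong j refl
... | no _    | no j≢j  = contradiction refl j≢j

edgeless : ∀ {n} → Components {n} []
edgeless = record
  { count   = _
  ; label   = id
  ; onto    = λ i → i , refl
  ; correct = λ x y → mk⇔ (λ { refl → ε })
      (EqClosure.fold isEquivalence (λ ()))
  }

addEdge′ : ∀ {n} {G : Multigraph n} a b c (ℓ : Fin n → Fin c) →
           (∀ i → ∃ λ x → ℓ x ≡ i) →
           (∀ x y → ℓ x ≡ ℓ y ⇔ Connected G x y) →
           Components ((a , b) ∷ G)
addEdge′ a b zero    ℓ ℓ-onto ℓ-correct with () ← ℓ a
addEdge′ {n} {G} a b (suc c) ℓ ℓ-onto ℓ-correct with ℓ b ≟ ℓ a
... | yes b≡a = record
  { count   = suc c
  ; label   = ℓ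
  ; onto    = ℓ-onto
  ; correct = λ x y → mk⇔ (EqClosure.map there ∘ Equivalence.to (ℓ-correct x y))
      (EqClosure.fold (On.isEquivalence ℓ isEquivalence)
        λ { (here refl) → sym b≡a
          ; {x} {y} (there p) → Equivalence.from (ℓ-correct x y) (fwd p ◅ ε) })
  }
... | no b≢a = record
  { count   = c
  ; label   = ℓ′
  ; onto    = λ i → let x , ℓx≡ = ℓ-onto (punchIn (ℓ b) i) in
      x , trans (cong f ℓx≡) (contract-onto (ℓ a) (ℓ b) b≢a i)
  ; correct = λ x y → mk⇔ (to x y)
      (EqClosure.fold (On.isEquivalence ℓ′ isEquivalence)
        λ { (here refl) → contract-merges (ℓ a) (ℓ b) b≢a
          ; {x} {y} (there p) → cong f (Equivalence.from (ℓ-correct x y) (fwd p ◅ ε)) })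
  }
  where
  f : Fin (suc c) → Fin c
  f = contract (ℓ a) (ℓ b) b≢a

  ℓ′ : Fin n → Fin c
  ℓ′ = f ∘ ℓ

  old : ∀ {x y} → ℓ x ≡ ℓ y → Connected ((a , b) ∷ G) x y
  old = EqClosure.map there ∘ Equivalence.to (ℓ-correct _ _)

  to : ∀ x y → ℓ′ x ≡ ℓ′ y → Connected ((a , b) ∷ G) x y
  to x y eq with ℓ b ≟ ℓ x | ℓ b ≟ ℓ y
  ... | yes bx  | yes by  = old (trans (sym bx) by)
  ... | yes bx  | no  b≢y =
          old (sym bx) ◅◅ bwd (here refl) ◅ old (punchOut-injective b≢a b≢y eq)
  ... | no  b≢x | yes by  =
          old (punchOut-injective b≢x b≢a eq) ◅◅ fwd (here refl) ◅ old by
  ... | no  b≢x | no  b≢y = old (punchOut-injective b≢x b≢y eq)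

addEdge : ∀ {n} {G : Multigraph n} a b → Components G → Components ((a , b) ∷ G)
addEdge a b C = addEdge′ a b count label onto correct
  where open Components C

components : ∀ {n} (G : Multigraph n) → Components G
components []            = edgeless
components ((a , b) ∷ G) = addEdge a b (components G)

-- Finite multisets are represented by lists, whose order plays no role: a
-- hyperedge is a list of vertices, repeated according to multiplicity, and
-- parallel hyperedges occupy different positions of E.
Hyperedge : ℕ → Set
Hyperedge v = List (Fin v)

d : ∀ {v} → Hyperedge v → ℕ
d = length

record Hypergraph : Set where
  field
    v   : ℕ
    E   : List (Hyperedge v)
    d>1 : All (λ e → 1 < d e) E

Uniform : ℕ → Hypergraph → Set
Uniform n H = All (λ e → d e ≡ n) (Hypergraph.E H)

-- The bipartite incidence graph of (Fin v , A): the vertices are numbered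
-- first, then the hyperedges, and u is joined to the i-th hyperedge once for
-- every occurrence of u in it.
incidenceGraph : ∀ {v} (A : List (Hyperedge v)) → Multigraph (v ℕ.+ length A)
incidenceGraph {v} A =
  concat (tabulate λ i → map (λ u → u ↑ˡ length A , v ↑ʳ i) (lookup A i))

κ : ∀ {v} → List (Hyperedge v) → ℕ
κ A = Components.count (components (incidenceGraph A))

dₛ : ∀ {v} → List (Hyperedge v) → ℕ
dₛ A = sum (map d A)

-- One entry for every set of positions of the list, so that parallel
-- hyperedges are treated as distinct.
subfamilies : ∀ {a} {X : Set a} → List X → List (List X)
subfamilies []       = [] ∷ []
subfamilies (x ∷ xs) = subfamilies xs ++ map (x ∷_) (subfamilies xs)

-- The identities are algebraic, so the complex numbers are replaced by any
-- Heyting field; for a classical field, x # y is the negation of x ≈ y.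
module OverField {c ℓ₁ ℓ₂} (K : HeytingField c ℓ₁ ℓ₂) where
  open HeytingField K hiding (refl; sym; trans)
  private
    module K = HeytingField K
    R : CommutativeRing c ℓ₁
    R = HeytingCommutativeRing.commutativeRing K.heytingCommutativeRing
    open HeytingProperties K.heytingCommutativeRing
      using (x-0≈x; invertibleʳ⇒#)

  open Exp (CommutativeRing.semiring R) public using (_^_)

  infixl 7 _/_⟨_⟩

  _/_⟨_⟩ : (x y : Carrier) → y # 0# → Carrier
  x / y ⟨ y#0 ⟩ = x * proj₁ (#⇒invertible y#0)

  root#0 : ∀ k {w r} → w ^ k # 1# → r ^ k ≈ w ^ k - 1# → r # 0#
  root#0 zero    1#1 _  = contradiction 1#1 (#-irrefl K.refl)
  root#0 (suc k) {w} {r} w#1 eq with #⇒invertible w#1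
  ... | u , _ , inv = invertibleʳ⇒# (r ^ k * u , proof)
    where
    proof : (r - 0#) * (r ^ k * u) ≈ 1#
    proof = K.trans (*-congʳ (x-0≈x r))
           (K.trans (K.sym (*-assoc r (r ^ k) u))
           (K.trans (*-congʳ eq) inv))

  ∑⊆ : ∀ {v} (E : List (Hyperedge v)) → (List (Hyperedge v) → Carrier) → Carrier
  ∑⊆ E f = foldr _+_ 0# (map f (subfamilies E))

  ∏∈ : ∀ {v} (A : List (Hyperedge v)) → (Hyperedge v → Carrier) → Carrier
  ∏∈ A f = foldr _*_ 1# (map f A)

  -- The exponents never truncate: κ E ≤ κ A for A ⊆ E, and the incidence graph
  -- of (V , A) has v + length A vertices and dₛ A edges, so that its cyclomatic
  -- number dₛ A ∸ (v + length A) + κ A is nonnegative.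
  THG : Hypergraph → Carrier → Carrier → Carrier
  THG H x y = ∑⊆ E λ A →
      (x - 1#) ^ (κ A ∸ κ E)
    * (y - 1#) ^ ((dₛ A ℕ.+ κ A) ∸ (length A ℕ.+ v))
    where open Hypergraph H

  ZPotts : Hypergraph → Carrier → Carrier → Carrier
  ZPotts H q w = ∑⊆ E λ A → q ^ κ A * ∏∈ A λ e → w ^ (d e ∸ 1) - 1#
    where open Hypergraph H

{-# OPTIONS --safe #-}

-- The two sums agree term by term. With q = r t, the factors r and t of q
-- separate, and for A ⊆ E both terms equal
--   q ^ κ E * t ^ (κ A - κ E) * r ^ (κ A - κ E + k |A|),
-- because d A = (k + 1) |A| makes the powers of r on the right,
-- (v - κ E) + (d A - |A| - v + κ A), add up to the same exponent. Subtraction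
-- of naturals is harmless here: κ E ≤ κ A and κ E ≤ v, since every component
-- of (V , E) contains a vertex and is a union of components of (V , A), and
-- |A| + v ≤ d A + κ A, since adding an edge to a graph merges at most two
-- components.
module Submission where

open import Defs
open import Algebra.Apartness.Bundles using (HeytingCommutativeRing; HeytingField)
open import Algebra.Bundles using (CommutativeRing)
import Algebra.Properties.AbelianGroup as AbelianGroupProperties
import Algebra.Properties.CommutativeSemigroup as CommutativeSemigroupProperties
import Algebra.Properties.CommutativeSemiring.Exp as CommutativeExp
open import Data.Fin.Base using (Fin; _↑ˡ_; _↑ʳ_; splitAt; join)
open import Data.Fin.Properties
  using (_≟_; injective⇒≤; splitAt-↑ˡ; splitAt-↑ʳ; splitAt⁻¹-↑ˡ; splitAt⁻¹-↑ʳ)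
open import Data.List.Base
  using (List; []; _∷_; map; foldr; length; concat; tabulate; lookup)
open import Data.List.Membership.Propositional using (_∈_)
open import Data.List.Membership.Propositional.Properties
  using (∈-concat⁺′; ∈-concat⁻′; ∈-map⁺; ∈-map⁻; ∈-tabulate⁺; ∈-tabulate⁻; ∈-lookup)
open import Data.List.Properties
  using (length-++; length-map; map-tabulate; tabulate-cong; tabulate-lookup)
open import Data.List.Relation.Binary.Subset.Propositional using (_⊆_)
open import Data.List.Relation.Unary.All as All using (All; []; _∷_)
open import Data.List.Relation.Unary.All.Properties using (++⁺; map⁺)
open import Data.List.Relation.Unary.Any using (here; index)
open import Data.List.Relation.Unary.Any.Properties using (lookup-index)
open import Data.Nat.Base as ℕ using (ℕ; zero; suc; _<_; _≤_; _∸_; _≥_)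
open import Data.Nat.ListAction using (sum)
import Data.Nat.Properties as ℕ
open import Data.Nat.Tactic.RingSolver using (solve-∀)
open import Data.Product.Base using (∃; ∃₂; _×_; _,_; proj₁; proj₂)
open import Data.Sum.Base using (inj₁; inj₂; map₂)
open import Function.Base using (_∘_; id)
open import Function.Bundles using (Equivalence)
import Relation.Binary.Construct.Closure.Equivalence as EqClosure
open import Relation.Binary.Construct.Closure.ReflexiveTransitive using (ε; _◅_)
open import Relation.Binary.Construct.Closure.Symmetric using (fwd)
open import Relation.Binary.PropositionalEquality
  using (_≡_; refl; sym; trans; cong; cong₂; subst; subst₂; module ≡-Reasoning)
import Relation.Binary.Reasoning.Setoid as ≈-Reasoning
open import Relation.Nullary using (yes; no)

-- Lists and their subfamilies.

length-concat : ∀ {a} {X : Set a} (xss : List (List X)) →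
                length (concat xss) ≡ sum (map length xss)
length-concat []         = refl
length-concat (xs ∷ xss) =
  trans (length-++ xs) (cong (length xs ℕ.+_) (length-concat xss))

All-subfamilies : ∀ {a p} {X : Set a} {P : X → Set p} {xs} →
                  All P xs → All (All P) (subfamilies xs)
All-subfamilies []         = [] ∷ []
All-subfamilies (px ∷ pxs) =
  ++⁺ (All-subfamilies pxs) (map⁺ (All.map (px ∷_) (All-subfamilies pxs)))

-- Effect of edges on the number of components.

-- The case split follows that of `addEdge′`: an edge inside a component keeps the count, and an
-- edge between two components lowers it by exactly one.
count-addEdge′ : ∀ {n} {G : Multigraph n} a b c ℓ onto correct →
                 c ≤ suc (Components.count (addEdge′ {G = G} a b c ℓ onto correct))
count-addEdge′ a b zero    ℓ _ _ with () ← ℓ a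
count-addEdge′ a b (suc c) ℓ _ _ with ℓ b ≟ ℓ a
... | yes _ = ℕ.n≤1+n _
... | no  _ = ℕ.≤-refl

-- Induction on the edges: the edgeless graph has `n` components, and each edge destroys at most one
-- of them.
vertices≤edges+components : ∀ {n} (G : Multigraph n) →
                            n ≤ length G ℕ.+ Components.count (components G)
vertices≤edges+components []            = ℕ.≤-refl
vertices≤edges+components {n} ((a , b) ∷ G) = begin
  n                                    ≤⟨ vertices≤edges+components G ⟩
  length G ℕ.+ count                   ≤⟨ ℕ.+-monoʳ-≤ (length G) (count-addEdge′ a b count label onto correct) ⟩
  length G ℕ.+ suc (Components.count (addEdge a b (components G)))
                                       ≡⟨ ℕ.+-suc (length G) _ ⟩
  suc (length G) ℕ.+ Components.count (addEdge a b (components G)) ∎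
  where
  open ℕ.≤-Reasoning
  open Components (components G)

-- Incidence graphs and the bounds on `κ`.

module _ {v : ℕ} where

  incidences : (A : List (Hyperedge v)) → Fin (length A) → Multigraph (v ℕ.+ length A)
  incidences A i = map (λ u → u ↑ˡ length A , v ↑ʳ i) (lookup A i)

  length-incidenceGraph : (A : List (Hyperedge v)) → length (incidenceGraph A) ≡ dₛ A
  length-incidenceGraph A = begin
    length (concat (tabulate (incidences A)))   ≡⟨ length-concat (tabulate (incidences A)) ⟩
    sum (map length (tabulate (incidences A)))  ≡⟨ cong sum (map-tabulate (incidences A) length) ⟩
    sum (tabulate (length ∘ incidences A))      ≡⟨ cong sum (tabulate-cong λ i → length-map _ (lookup A i)) ⟩
    sum (tabulate (d ∘ lookup A))               ≡⟨ cong sum (map-tabulate (lookup A) d) ⟨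
    sum (map d (tabulate (lookup A)))           ≡⟨ cong (sum ∘ map d) (tabulate-lookup A) ⟩
    dₛ A                                        ∎
    where open ≡-Reasoning

  cyclomatic-nonneg : (A : List (Hyperedge v)) → length A ℕ.+ v ≤ dₛ A ℕ.+ κ A
  cyclomatic-nonneg A = subst₂ _≤_ (ℕ.+-comm v (length A))
    (cong (ℕ._+ κ A) (length-incidenceGraph A))
    (vertices≤edges+components (incidenceGraph A))

  incident : (A : List (Hyperedge v)) → ∀ {u i} → u ∈ lookup A i →
             Adjacent (incidenceGraph A) (u ↑ˡ length A) (v ↑ʳ i)
  incident A {i = i} u∈ = ∈-concat⁺′ (∈-map⁺ _ u∈) (∈-tabulate⁺ {f = incidences A} i)

  incident⁻ : (A : List (Hyperedge v)) → ∀ {x y} → Adjacent (incidenceGraph A) x y →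
              ∃₂ λ u i → u ∈ lookup A i × x ≡ u ↑ˡ length A × y ≡ v ↑ʳ i
  incident⁻ A p with ∈-concat⁻′ (tabulate (incidences A)) p
  ... | _ , p∈ , incidences∈ with ∈-tabulate⁻ incidences∈
  ...   | i , refl with ∈-map⁻ _ p∈
  ...     | u , u∈ , refl = u , i , u∈ , refl , refl

  module _ {A B : List (Hyperedge v)} (A⊆B : A ⊆ B) where

    -- Equal hyperedges of A may land on the same position of B: that is enough
    -- to preserve adjacency, so A ⊆ B need not respect multiplicities.
    position : Fin (length A) → Fin (length B)
    position i = index (A⊆B (∈-lookup {xs = A} i))

    embed : Fin (v ℕ.+ length A) → Fin (v ℕ.+ length B)
    embed x = join v (length B) (map₂ position (splitAt v x))

    embed-↑ˡ : ∀ u → embed (u ↑ˡ length A) ≡ u ↑ˡ length B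
    embed-↑ˡ u = cong (join v (length B) ∘ map₂ position) (splitAt-↑ˡ v u (length A))

    embed-↑ʳ : ∀ i → embed (v ↑ʳ i) ≡ v ↑ʳ position i
    embed-↑ʳ i = cong (join v (length B) ∘ map₂ position) (splitAt-↑ʳ v (length A) i)

    embed-adjacent : ∀ {x y} → Adjacent (incidenceGraph A) x y →
                     Adjacent (incidenceGraph B) (embed x) (embed y)
    embed-adjacent p with incident⁻ A p
    ... | u , i , u∈ , refl , refl =
      subst₂ (Adjacent (incidenceGraph B)) (sym (embed-↑ˡ u)) (sym (embed-↑ʳ i))
        -- `lookup-index` identifies the hyperedge of `A` at `i` with that of `B` at `position i`,
        -- so it still contains `u`.
        (incident B (subst (u ∈_) (lookup-index (A⊆B (∈-lookup {xs = A} i))) u∈))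

    -- `embed` is a graph homomorphism fixing the vertices of the hypergraph, so it carries paths to
    -- paths.
    connected-mono : ∀ {u u′} →
      Connected (incidenceGraph A) (u ↑ˡ length A) (u′ ↑ˡ length A) →
      Connected (incidenceGraph B) (u ↑ˡ length B) (u′ ↑ˡ length B)
    connected-mono {u} {u′} c =
      subst₂ (Connected (incidenceGraph B)) (embed-↑ˡ u) (embed-↑ˡ u′)
        (EqClosure.gmap embed embed-adjacent c)

  module _ {B : List (Hyperedge v)} (d>1 : All (λ e → 1 < d e) B) where

    private module B = Components (components (incidenceGraph B))

    -- Here `d>1` enters: a hyperedge is nonempty, so no component consists of a hyperedge node
    -- alone.
    connected-to-vertex : ∀ x → ∃ λ u → Connected (incidenceGraph B) (u ↑ˡ length B) x
    connected-to-vertex x with splitAt v x in eq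
    ... | inj₁ u rewrite sym (splitAt⁻¹-↑ˡ eq) = u , ε
    ... | inj₂ i rewrite sym (splitAt⁻¹-↑ʳ eq) =
      let u , u∈ = member (All.lookup d>1 (∈-lookup i)) in u , fwd (incident B u∈) ◅ ε
      where
      member : ∀ {e : Hyperedge v} → 1 < d e → ∃ (_∈ e)
      member {u ∷ _} _ = u , here refl

    representative : ∀ i → ∃ λ u → B.label (u ↑ˡ length B) ≡ i
    representative i =
      let x , label-x = B.onto i
          u , u~x = connected-to-vertex x
      in u , trans (Equivalence.from (B.correct _ _) u~x) label-x

    rep : Fin (κ B) → Fin v
    rep = proj₁ ∘ representative

    -- The label of `rep i` is `i`, and connected nodes share a label. Both bounds below follow by
    -- exhibiting an injection from `Fin (κ B)`.
    rep-injective : ∀ {i j} →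
      Connected (incidenceGraph B) (rep i ↑ˡ length B) (rep j ↑ˡ length B) → i ≡ j
    rep-injective {i} {j} c = trans (sym (proj₂ (representative i)))
      (trans (Equivalence.from (B.correct _ _) c) (proj₂ (representative j)))

    κ≤v : κ B ≤ v
    κ≤v = injective⇒≤ {f = rep} λ {i} {j} eq → rep-injective {i} {j}
      (subst (λ u → Connected _ (rep i ↑ˡ _) (u ↑ˡ _)) eq ε)

    -- Each component of `B` is sent to the component of its representative in `A`. If two images
    -- agree, the representatives are connected in `A`, hence in `B`.
    κ-antitone : ∀ {A} → A ⊆ B → κ B ≤ κ A
    κ-antitone {A} A⊆B = injective⇒≤ {f = A.label ∘ (_↑ˡ length A) ∘ rep}
      λ {i} {j} eq → rep-injective {i} {j}
        (connected-mono A⊆B (Equivalence.to (A.correct _ _) eq))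
      where module A = Components (components (incidenceGraph A))

-- Arithmetic of the exponents.

dₛ-uniform : ∀ {v n} {A : List (Hyperedge v)} →
             All (λ e → d e ≡ n) A → dₛ A ≡ length A ℕ.* n
dₛ-uniform []       = refl
dₛ-uniform (p ∷ ps) = cong₂ ℕ._+_ p (dₛ-uniform ps)

-- The inequalities say that none of the subtractions truncates.
exponents-balance : ∀ {κA κE v dA nA k} → κE ≤ κA → κE ≤ v → nA ℕ.+ v ≤ dA ℕ.+ κA →
  dA ≡ nA ℕ.* suc k →
  (κA ∸ κE) ℕ.+ k ℕ.* nA ≡ (v ∸ κE) ℕ.+ (dA ℕ.+ κA ∸ (nA ℕ.+ v))
exponents-balance {κA} {κE} {v} {_} {nA} {k} κE≤κA κE≤v n+v≤d+κ refl =
  -- The summand added to both sides undoes every truncated subtraction: `κE` restores `κA` on the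
  -- left and `v` on the right, and `nA + v` restores `dA + κA`.
  ℕ.+-cancelʳ-≡ (κE ℕ.+ (nA ℕ.+ v)) _ _ (begin
    (a ℕ.+ k ℕ.* nA) ℕ.+ (κE ℕ.+ (nA ℕ.+ v))   ≡⟨ collect a k nA κE v ⟩
    nA ℕ.* suc k ℕ.+ (a ℕ.+ κE) ℕ.+ v          ≡⟨ cong (λ m → nA ℕ.* suc k ℕ.+ m ℕ.+ v) (ℕ.m∸n+n≡m κE≤κA) ⟩
    nA ℕ.* suc k ℕ.+ κA ℕ.+ v                  ≡⟨ cong₂ ℕ._+_ (ℕ.m∸n+n≡m n+v≤d+κ) (ℕ.m∸n+n≡m κE≤v) ⟨
    (c ℕ.+ (nA ℕ.+ v)) ℕ.+ (b ℕ.+ κE)          ≡⟨ regroup b c nA κE v ⟩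
    (b ℕ.+ c) ℕ.+ (κE ℕ.+ (nA ℕ.+ v))          ∎)
  where
  open ≡-Reasoning
  a b c : ℕ
  a = κA ∸ κE
  b = v ∸ κE
  c = nA ℕ.* suc k ℕ.+ κA ∸ (nA ℕ.+ v)

  collect : ∀ a k n κ v → (a ℕ.+ k ℕ.* n) ℕ.+ (κ ℕ.+ (n ℕ.+ v))
                        ≡ n ℕ.* suc k ℕ.+ (a ℕ.+ κ) ℕ.+ v
  collect = solve-∀

  regroup : ∀ b c n κ v → (c ℕ.+ (n ℕ.+ v)) ℕ.+ (b ℕ.+ κ)
                        ≡ (b ℕ.+ c) ℕ.+ (κ ℕ.+ (n ℕ.+ v))
  regroup = solve-∀

-- Field identities and the comparison of terms.

module FieldProperties {c ℓ₁ ℓ₂} (K : HeytingField c ℓ₁ ℓ₂) where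
  private
    R : CommutativeRing c ℓ₁
    R = HeytingCommutativeRing.commutativeRing (HeytingField.heytingCommutativeRing K)
  open HeytingField K using (_#_; #⇒invertible)
  open CommutativeRing R hiding (refl; sym; trans; zero)
  private module K = CommutativeRing R
  open CommutativeExp commutativeSemiring using (^-congˡ; ^-congʳ; ^-homo-*; ^-assocʳ; ^-distrib-*)
  open AbelianGroupProperties +-abelianGroup using (ε⁻¹≈ε; //-rightDividesʳ)
  open CommutativeSemigroupProperties *-commutativeSemigroup using (xy∙z≈xz∙y)
  open OverField K
  open ≈-Reasoning setoid

  *-/-cancel : ∀ x y (y#0 : y # 0#) → y * (x / y ⟨ y#0 ⟩) ≈ x
  *-/-cancel x y y#0 with #⇒invertible y#0
  ... | y⁻¹ , _ , inv = begin
    y * (x * y⁻¹)         ≈⟨ *-comm y (x * y⁻¹) ⟩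
    x * y⁻¹ * y           ≈⟨ *-assoc x y⁻¹ y ⟩
    x * (y⁻¹ * y)         ≈⟨ *-congˡ (*-comm y⁻¹ y) ⟩
    -- Apartness from `0#` yields an inverse of `y - 0#`, so the zero has to be inserted first.
    x * (y * y⁻¹)         ≈⟨ *-congˡ (*-congʳ (K.trans (+-congˡ ε⁻¹≈ε) (+-identityʳ y))) ⟨
    x * ((y - 0#) * y⁻¹)  ≈⟨ *-congˡ inv ⟩
    x * 1#                ≈⟨ *-identityʳ x ⟩
    x                     ∎

  ∑-scale : ∀ {a} {X : Set a} {f g : X → Carrier} s {xs} →
            All (λ x → f x ≈ s * g x) xs →
            foldr _+_ 0# (map f xs) ≈ s * foldr _+_ 0# (map g xs)
  ∑-scale s []       = K.sym (zeroʳ s)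
  ∑-scale s (p ∷ ps) = K.trans (+-cong p (∑-scale s ps)) (K.sym (distribˡ s _ _))

  ∏-const : ∀ {v} {f : Hyperedge v → Carrier} {s A} →
            All (λ e → f e ≈ s) A → ∏∈ A f ≈ s ^ length A
  ∏-const []       = K.refl
  ∏-const (p ∷ ps) = *-cong p (∏-const ps)

  -- Only the `a` extra factors of `q` are split into `r` and `t`; the powers of `r` then merge, and
  -- the balance of exponents redistributes them. No division occurs.
  monomial-rescale : ∀ {q r t} (r*t≈q : r * t ≈ q) k n κE a b c →
    a ℕ.+ k ℕ.* n ≡ b ℕ.+ c →
    q ^ (κE ℕ.+ a) * (r ^ k) ^ n ≈ q ^ κE * r ^ b * (t ^ a * r ^ c)
  monomial-rescale {q} {r} {t} r*t≈q k n κE a b c eq = begin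
    q ^ (κE ℕ.+ a) * (r ^ k) ^ n               ≈⟨ *-cong (^-homo-* q κE a) (^-assocʳ r k n) ⟩
    q ^ κE * q ^ a * r ^ (k ℕ.* n)             ≈⟨ *-congʳ (*-congˡ (^-congˡ a r*t≈q)) ⟨
    q ^ κE * (r * t) ^ a * r ^ (k ℕ.* n)       ≈⟨ *-congʳ (*-congˡ (^-distrib-* r t a)) ⟩
    q ^ κE * (r ^ a * t ^ a) * r ^ (k ℕ.* n)   ≈⟨ *-assoc _ _ _ ⟩
    q ^ κE * (r ^ a * t ^ a * r ^ (k ℕ.* n))   ≈⟨ *-congˡ (xy∙z≈xz∙y _ _ _) ⟩
    q ^ κE * (r ^ a * r ^ (k ℕ.* n) * t ^ a)   ≈⟨ *-congˡ (*-congʳ (^-homo-* r a (k ℕ.* n))) ⟨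
    q ^ κE * (r ^ (a ℕ.+ k ℕ.* n) * t ^ a)     ≈⟨ *-congˡ (*-congʳ (^-congʳ r eq)) ⟩
    q ^ κE * (r ^ (b ℕ.+ c) * t ^ a)           ≈⟨ *-congˡ (*-congʳ (^-homo-* r b c)) ⟩
    q ^ κE * (r ^ b * r ^ c * t ^ a)           ≈⟨ *-congˡ (*-assoc _ _ _) ⟩
    q ^ κE * (r ^ b * (r ^ c * t ^ a))         ≈⟨ *-assoc _ _ _ ⟨
    q ^ κE * r ^ b * (r ^ c * t ^ a)           ≈⟨ *-congˡ (*-comm _ _) ⟩
    q ^ κE * r ^ b * (t ^ a * r ^ c)           ∎

  module _ (k : ℕ) (H : Hypergraph) (uniform : Uniform (suc k) H) where
    open Hypergraph H

    term-rescale : ∀ {q w r t} → r ^ k ≈ w ^ k - 1# → r * t ≈ q → ∀ {A} → A ⊆ E →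
      q ^ κ A * ∏∈ A (λ e → w ^ (d e ∸ 1) - 1#) ≈
      q ^ κ E * r ^ (v ∸ κ E) *
        (((t + 1#) - 1#) ^ (κ A ∸ κ E) *
         ((r + 1#) - 1#) ^ ((dₛ A ℕ.+ κ A) ∸ (length A ℕ.+ v)))
    term-rescale {q} {w} {r} {t} root r*t≈q {A} A⊆E = begin
      q ^ κ A * ∏∈ A (λ e → w ^ (d e ∸ 1) - 1#)
        -- By uniformity every hyperedge has weight `w ^ k - 1#`, which is `r ^ k`.
        ≈⟨ *-cong (^-congʳ q (sym (ℕ.m+[n∸m]≡n κE≤κA))) (∏-const (All.map (λ {e} → weight e) uniformA)) ⟩
      q ^ (κ E ℕ.+ a) * (r ^ k) ^ length A
        ≈⟨ monomial-rescale r*t≈q k (length A) (κ E) a (v ∸ κ E) b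
             (exponents-balance κE≤κA (κ≤v d>1) (cyclomatic-nonneg A) (dₛ-uniform uniformA)) ⟩
      q ^ κ E * r ^ (v ∸ κ E) * (t ^ a * r ^ b)
        ≈⟨ *-congˡ (*-cong (^-congˡ a (//-rightDividesʳ 1# t)) (^-congˡ b (//-rightDividesʳ 1# r))) ⟨
      q ^ κ E * r ^ (v ∸ κ E) * (((t + 1#) - 1#) ^ a * ((r + 1#) - 1#) ^ b) ∎
      where
      a b : ℕ
      a = κ A ∸ κ E
      b = (dₛ A ℕ.+ κ A) ∸ (length A ℕ.+ v)

      κE≤κA : κ E ≤ κ A
      κE≤κA = κ-antitone d>1 A⊆E

      uniformA : All (λ e → d e ≡ suc k) A
      uniformA = All.tabulate (All.lookup uniform ∘ A⊆E)

      weight : ∀ (e : Hyperedge v) → d e ≡ suc k → w ^ (d e ∸ 1) - 1# ≈ r ^ k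
      weight _ de≡ = K.trans (+-congʳ (^-congʳ w (cong (_∸ 1) de≡))) (K.sym root)

corollary5p10 : ∀ {c ℓ₁ ℓ₂} (K : HeytingField c ℓ₁ ℓ₂) →
    let open HeytingField K
        open OverField K in
    ∀ (k : ℕ) → k ≥ 1 →
    ∀ (H : Hypergraph) → Uniform (suc k) H →
    let open Hypergraph H in
    ∀ (q w r : Carrier) (w^k≠1 : w ^ k # 1#) (root : r ^ k ≈ w ^ k - 1#) →
    let r≠0 = root#0 k w^k≠1 root in
    ZPotts H q w ≈ q ^ κ E * r ^ (v ∸ κ E) * THG H (q / r ⟨ r≠0 ⟩ + 1#) (r + 1#)
corollary5p10 K k _ H uniform q w r w^k≠1 root =
  -- The prefactor does not depend on the subfamily, so a termwise identity suffices, with `t` the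
  -- quotient of `q` by `r`.
  ∑-scale (q ^ κ E * r ^ (v ∸ κ E))
    (All.map (λ A∈E → term-rescale k H uniform root
                        (*-/-cancel q r (root#0 k w^k≠1 root)) (All.lookup A∈E))
             -- Taking membership in `E` as the predicate shows that every subfamily is contained in
             -- `E`.
             (All-subfamilies (All.tabulate {P = _∈ E} id)))
  where
  open HeytingField K using (_*_)
  open OverField K
  open FieldProperties K
  open Hypergraph H
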